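{- Consider the nonpreemptive Lazy Bureaucrat Problem in which every job has unit processing time ($t_1=\cdots=t_n=1$) and all data are integers. The Latest Due Date (LDD) policy — at each integer time $\tau$ at which the processor is free, if some job is executable at $\tau$, start an executable job with the largest deadline (ties broken arbitrarily) — produces a feasible schedule that minimizes objective (1), the total amount of executed work, over all feasible schedules.
   Context: An instance of the Lazy Bureaucrat Problem (LBP) consists of jobs $1,\dots,n$; job $i$ has a processing time $t_i$, an arrival time $a_i$ and a deadline $d_i$, all nonnegative integers. Its critical time is $c_i=d_i-t_i$. A single processor (the bureaucrat) processes at most one job at a time. In the nonpreemptive setting, a schedule chooses a set of executed jobs and, for each executed job $i$, a start time $s_i$ with $a_i\le s_i\le c_i$; job $i$ is then processed without interruption during $[s_i,s_i+t_i)$, these intervals are pairwise disjoint, and each job is executed at most once. A job $i$ is executable at time $\tau$ if it has not been started before $\tau$ and $a_i\le\tau\le c_i$. A schedule is feasible if it satisfies the busy requirement: at every time $\tau$ at which the processor is not processing a job, no job is executable. Objective (1) is the total time spent working, $\sum t_i$ over executed jobs, to be minimized over feasible schedules. -}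

module Defs where

open import Level using (Level; 0ℓ; _⊔_) renaming (suc to lsuc)
open import Algebra.Bundles using (AbelianGroup)
open import Algebra.Structures using (IsAbelianGroup)
open import Data.Fin.Base using (Fin)
open import Data.Maybe.Base using (Maybe; just; nothing; maybe′)
open import Data.Nat.Base as ℕ using (ℕ; suc)
import Data.Nat.Properties as ℕ
open import Data.Product.Base using (∃-syntax; _×_; _,_)
import Data.Rational.Base as ℚ
import Data.Rational.Properties as ℚ
open import Data.Vec.Functional using (Vector; replicate; updateAt)
open import Function.Base using (const)
open import Relation.Binary.Core using (Rel)
open import Relation.Binary.Structures using (IsDecTotalOrder)
import Relation.Binary.Construct.NonStrictToStrict as ToStrict
open import Relation.Binary.PropositionalEquality.Core using (_≡_; _≢_)
open import Relation.Nullary.Negation.Core using (¬_)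
import Algebra.Definitions.RawMonoid as RawMonoidDefinitions
import Algebra.Properties.CommutativeMonoid.Sum as Summation

-- The time axis: a linearly ordered abelian group with a positive unit.
-- Integers, rationals and (classically) reals are all instances, so start
-- times and idle moments are not assumed to be integral.
record TimeAxis (c ℓ₁ ℓ₂ : Level) : Set (lsuc (c ⊔ ℓ₁ ⊔ ℓ₂)) where
  infix  4 _≈_ _≤_ _<_
  infixl 6 _+_ _-_
  infix  8 -_
  field
    Time            : Set c
    _≈_             : Rel Time ℓ₁
    _≤_             : Rel Time ℓ₂
    _+_             : Time → Time → Time
    0#              : Time
    -_              : Time → Time
    1#              : Time
    isAbelianGroup  : IsAbelianGroup _≈_ _+_ 0# -_
    isDecTotalOrder : IsDecTotalOrder _≈_ _≤_
    +-monoˡ-≤       : ∀ z {x y} → x ≤ y → x + z ≤ y + z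

  _<_ : Rel Time (ℓ₁ ⊔ ℓ₂)
  _<_ = ToStrict._<_ _≈_ _≤_

  field
    0<1 : 0# < 1#

  abelianGroup : AbelianGroup c ℓ₁
  abelianGroup = record { isAbelianGroup = isAbelianGroup }

  _-_ : Time → Time → Time
  x - y = x + - y

  open RawMonoidDefinitions (AbelianGroup.rawMonoid abelianGroup)
    using () renaming (_×_ to _·_)

  fromℕ : ℕ → Time
  fromℕ m = m · 1#

ℚ-timeAxis : TimeAxis 0ℓ 0ℓ 0ℓ
ℚ-timeAxis = record
  { isAbelianGroup  = ℚ.+-0-isAbelianGroup
  ; isDecTotalOrder = ℚ.≤-isDecTotalOrder
  ; +-monoˡ-≤       = ℚ.+-monoˡ-≤
  ; 0<1             = ℚ.<⇒≤ 0<1ℚ , ℚ.<⇒≢ 0<1ℚ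
  }
  where
  0<1ℚ : ℚ.0ℚ ℚ.< ℚ.1ℚ
  0<1ℚ = ℚ.positive⁻¹ ℚ.1ℚ

record LBP : Set where
  field
    n : ℕ
    t : Fin n → ℕ
    a : Fin n → ℕ
    d : Fin n → ℕ

module Scheduling {c ℓ₁ ℓ₂ : Level} (T : TimeAxis c ℓ₁ ℓ₂) (I : LBP) where
  open TimeAxis T
  open LBP I
  open Summation ℕ.+-0-commutativeMonoid using (sum)

  Job : Set
  Job = Fin n

  -- d i - t i is taken on the time axis, so it is negative when d i < t i.
  critical : Job → Time
  critical i = fromℕ (d i) - fromℕ (t i)

  -- The start time of each executed job; `nothing` for jobs not executed.
  Schedule : Set c
  Schedule = Vector (Maybe Time) n

  InInterval : Job → Time → Time → Set (ℓ₁ ⊔ ℓ₂)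
  InInterval i s τ = s ≤ τ × τ < s + fromℕ (t i)

  ProcessingAt : Schedule → Time → Set (c ⊔ ℓ₁ ⊔ ℓ₂)
  ProcessingAt σ τ = ∃[ i ] ∃[ s ] (σ i ≡ just s × InInterval i s τ)

  NotStartedBefore : Schedule → Job → Time → Set (c ⊔ ℓ₁ ⊔ ℓ₂)
  NotStartedBefore σ i τ = ∀ s → σ i ≡ just s → ¬ (s < τ)

  record Executable (σ : Schedule) (i : Job) (τ : Time) : Set (c ⊔ ℓ₁ ⊔ ℓ₂) where
    field
      notStarted : NotStartedBefore σ i τ
      arrived    : fromℕ (a i) ≤ τ
      notLate    : τ ≤ critical i

  record Feasible (σ : Schedule) : Set (c ⊔ ℓ₁ ⊔ ℓ₂) where
    field
      window   : ∀ i s → σ i ≡ just s → fromℕ (a i) ≤ s × s ≤ critical i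
      disjoint : ∀ i j s s′ → i ≢ j → σ i ≡ just s → σ j ≡ just s′ →
                 ∀ τ → ¬ (InInterval i s τ × InInterval j s′ τ)
      busy     : ∀ τ → ¬ ProcessingAt σ τ → ∀ i → ¬ Executable σ i τ

  work : Schedule → ℕ
  work σ = sum (λ i → maybe′ (const (t i)) 0 (σ i))

  MinimizesWork : Schedule → Set (c ⊔ ℓ₁ ⊔ ℓ₂)
  MinimizesWork σ = ∀ σ′ → Feasible σ′ → work σ ℕ.≤ work σ′

  record LatestDue (σ : Schedule) (τ : Time) (j : Job) : Set (c ⊔ ℓ₁ ⊔ ℓ₂) where
    field
      executable : Executable σ j τ
      latest     : ∀ k → Executable σ k τ → d k ℕ.≤ d j

  -- `LDDRun τ σ`: σ is a possible record of the starts made by the policy at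
  -- the integer times 0, …, τ - 1.  Ties are resolved nondeterministically.
  data LDDRun : ℕ → Schedule → Set (c ⊔ ℓ₁ ⊔ ℓ₂) where
    begin    : LDDRun 0 (replicate n nothing)
    continue : ∀ {τ σ} → LDDRun τ σ →
               ProcessingAt σ (fromℕ τ) →
               LDDRun (suc τ) σ
    idle     : ∀ {τ σ} → LDDRun τ σ →
               ¬ ProcessingAt σ (fromℕ τ) →
               (∀ i → ¬ Executable σ i (fromℕ τ)) →
               LDDRun (suc τ) σ
    start    : ∀ {τ σ} → LDDRun τ σ →
               ¬ ProcessingAt σ (fromℕ τ) →
               ∀ j → LatestDue σ (fromℕ τ) j →
               LDDRun (suc τ) (updateAt σ j (const (just (fromℕ τ))))

  -- No job can be started after its deadline, so a run past every deadline is
  -- complete.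
  LDDSchedule : Schedule → Set (c ⊔ ℓ₁ ⊔ ℓ₂)
  LDDSchedule σ = ∃[ H ] ((∀ i → d i ℕ.< H) × LDDRun H σ)

{-# OPTIONS --safe #-}

-- Time is discrete for feasible schedules: since arrivals are integral and a
-- busy bureaucrat never postpones an executable job, all starts are integral.
-- For integral schedules the invariant is that, for all m and x, the policy has
-- started before time m at most as many jobs with deadline below x as any
-- feasible schedule has.  When the policy starts a job with deadline below x
-- while the competitor does not, the competitor is strictly ahead already: if
-- it starts a job due at x or later, compare with the invariant for all
-- deadlines, since the policy has exhausted the jobs due at x or later; if it is
-- idle, compare with the invariant at x = m + 1, since the competitor has
-- exhausted the jobs still alive.

module Submission where

open import Defs
open import Level using (Level; _⊔_)
open import Algebra.Bundles using (AbelianGroup)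
import Algebra.Properties.CommutativeMonoid.Sum as Summation
import Algebra.Properties.Group as GroupProperties
open import Data.Bool.Base using (if_then_else_)
open import Data.Fin.Base using (Fin; zero; suc)
import Data.Fin.Properties as Fin
open import Data.Maybe.Base using (Maybe; just; nothing; maybe′)
import Data.Maybe.Properties as Maybe
open import Data.Maybe.Relation.Binary.Pointwise using (Pointwise; just; nothing)
open import Data.Maybe.Relation.Unary.Any as Any using (Any; just)
open import Data.Nat.Base as ℕ using (ℕ; zero; suc; s≤s; z≤n)
import Data.Nat.Properties as ℕ
open import Data.Product.Base using (∃-syntax; _×_; _,_; proj₁; proj₂)
open import Data.Sum.Base using (_⊎_; inj₁; inj₂)
open import Data.Unit.Base using (tt)
open import Data.Vec.Functional using (replicate; updateAt)
open import Data.Vec.Functional.Properties using (updateAt-updates; updateAt-minimal)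
open import Function.Base using (_∘_; const)
open import Relation.Binary.Bundles using (DecTotalOrder)
open import Relation.Binary.Core using (REL)
open import Relation.Binary.Definitions using (tri<; tri≈; tri>)
open import Relation.Binary.PropositionalEquality.Core using (_≡_; _≢_; refl; sym; trans; cong; subst)
open import Relation.Nullary.Decidable using (Dec; yes; no; does; _×-dec_; ¬?; decidable-stable)
open import Relation.Nullary.Negation.Core using (¬_; contradiction)
open import Relation.Unary using (Pred; Decidable)
import Relation.Binary.Properties.DecTotalOrder as DecTotalOrderProperties
import Relation.Binary.Construct.NonStrictToStrict as ToStrict

open Summation ℕ.+-0-commutativeMonoid using (sum; ∑-distrib-+; sum-cong-≗)

-- Comparison of finite sums, indicators and maxima.

sum-mono-≤ : ∀ {n} {f g : Fin n → ℕ} → (∀ i → f i ℕ.≤ g i) → sum f ℕ.≤ sum g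
sum-mono-≤ {zero}  f≤g = z≤n
sum-mono-≤ {suc n} f≤g = ℕ.+-mono-≤ (f≤g zero) (sum-mono-≤ (f≤g ∘ suc))

sum-mono-< : ∀ {n} {f g : Fin n → ℕ} → (∀ i → f i ℕ.≤ g i) →
             ∀ j → f j ℕ.< g j → sum f ℕ.< sum g
sum-mono-< f≤g zero    lt = ℕ.+-mono-<-≤ lt (sum-mono-≤ (f≤g ∘ suc))
sum-mono-< f≤g (suc j) lt = ℕ.+-mono-≤-< (f≤g zero) (sum-mono-< (f≤g ∘ suc) j lt)

sum-≤-suc : ∀ {n} {f g : Fin n → ℕ} (j : Fin n) → (∀ i → i ≢ j → f i ℕ.≤ g i) →
            f j ℕ.≤ suc (g j) → sum f ℕ.≤ suc (sum g)
sum-≤-suc zero f≤g le =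
  ℕ.+-mono-≤ le (sum-mono-≤ (λ i → f≤g (suc i) (λ ())))
sum-≤-suc {f = f} {g} (suc j) f≤g le = ℕ.≤-trans
  (ℕ.+-mono-≤ (f≤g zero (λ ())) (sum-≤-suc j (λ i i≢j → f≤g (suc i) (i≢j ∘ Fin.suc-injective)) le))
  (ℕ.≤-reflexive (ℕ.+-suc (g zero) (sum (g ∘ suc))))

-- Summing the pointwise bounds gives `sum f + sum g′ < sum f′ + sum g`, and `sum f′ ≤ sum g′` then
-- allows cancellation. This turns the invariant at one deadline threshold into a strict comparison
-- at another.
sum-exchange-< : ∀ {n} (f g f′ g′ : Fin n → ℕ) →
                 (∀ i → f i ℕ.+ g′ i ℕ.≤ f′ i ℕ.+ g i) →
                 ∀ j → f j ℕ.+ g′ j ℕ.< f′ j ℕ.+ g j →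
                 sum f′ ℕ.≤ sum g′ → sum f ℕ.< sum g
sum-exchange-< f g f′ g′ le j lt f′≤g′ = ℕ.+-cancelʳ-< (sum g′) (sum f) (sum g) (begin-strict
  sum f ℕ.+ sum g′            ≡⟨ ∑-distrib-+ f g′ ⟨
  sum (λ i → f i ℕ.+ g′ i)    <⟨ sum-mono-< le j lt ⟩
  sum (λ i → f′ i ℕ.+ g i)    ≡⟨ ∑-distrib-+ f′ g ⟩
  sum f′ ℕ.+ sum g            ≤⟨ ℕ.+-monoˡ-≤ (sum g) f′≤g′ ⟩
  sum g′ ℕ.+ sum g            ≡⟨ ℕ.+-comm (sum g′) (sum g) ⟩
  sum g ℕ.+ sum g′            ∎)
  where open ℕ.≤-Reasoning

indicator : ∀ {p} {P : Set p} → Dec P → ℕ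
indicator P? = if does P? then 1 else 0

module _ {p q : Level} {P : Set p} {Q : Set q} where

  indicator-mono-≤ : (P? : Dec P) (Q? : Dec Q) → (P → Q) → indicator P? ℕ.≤ indicator Q?
  indicator-mono-≤ (no _)  _       _   = z≤n
  indicator-mono-≤ (yes _) (yes _) _   = ℕ.≤-refl
  indicator-mono-≤ (yes p) (no ¬q) P⇒Q = contradiction (P⇒Q p) ¬q

  indicator-mono-< : (P? : Dec P) (Q? : Dec Q) → ¬ P → Q → indicator P? ℕ.< indicator Q?
  indicator-mono-< (yes p) _       ¬p _ = contradiction p ¬p
  indicator-mono-< (no _)  (yes _) _  _ = ℕ.≤-refl
  indicator-mono-< (no _)  (no ¬q) _  q = contradiction q ¬q

  indicator-≤-suc : (P? : Dec P) (Q? : Dec Q) → indicator P? ℕ.≤ suc (indicator Q?)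
  indicator-≤-suc (yes _) _ = s≤s z≤n
  indicator-≤-suc (no _)  _ = z≤n

argmax : ∀ {n p} {P : Pred (Fin n) p} → Decidable P → (f : Fin n → ℕ) →
         (∀ i → ¬ P i) ⊎ (∃[ j ] (P j × ∀ i → P i → f i ℕ.≤ f j))
argmax {zero}  P? f = inj₁ λ ()
argmax {suc n} P? f with P? zero | argmax (P? ∘ suc) (f ∘ suc)
... | no ¬p₀ | inj₁ none          = inj₁ λ { zero → ¬p₀ ; (suc i) → none i }
... | no ¬p₀ | inj₂ (j , p , max) = inj₂ (suc j , p , λ
  { zero p₀ → contradiction p₀ ¬p₀ ; (suc i) → max i })
... | yes p₀ | inj₁ none          = inj₂ (zero , p₀ , λ
  { zero _ → ℕ.≤-refl ; (suc i) p → contradiction p (none i) })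
... | yes p₀ | inj₂ (j , p , max) with ℕ.≤-total (f zero) (f (suc j))
...   | inj₁ f₀≤fⱼ = inj₂ (suc j , p , λ { zero _ → f₀≤fⱼ ; (suc i) → max i })
...   | inj₂ fⱼ≤f₀ = inj₂ (zero , p₀ , λ
  { zero _ → ℕ.≤-refl ; (suc i) pᵢ → ℕ.≤-trans (max i pᵢ) fⱼ≤f₀ })

upper-bound : ∀ {n} (f : Fin n → ℕ) → ∃[ H ] (∀ i → f i ℕ.< H)
upper-bound f with argmax (λ _ → yes tt) f
... | inj₁ none          = 0 , λ i → contradiction tt (none i)
... | inj₂ (j , _ , max) = suc (f j) , λ i → s≤s (max i tt)

-- Integer plans for unit jobs.

module UnitPlans {n : ℕ} (a d : Fin n → ℕ) where

  Plan : Set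
  Plan = Fin n → Maybe ℕ

  StartedBefore : Plan → ℕ → Fin n → Set
  StartedBefore b m i = Any (ℕ._< m) (b i)

  startedBefore? : ∀ b m → Decidable (StartedBefore b m)
  startedBefore? b m i = Any.dec (ℕ._<? m) (b i)

  startsAt? : ∀ (b : Plan) m → Decidable (λ i → b i ≡ just m)
  startsAt? b m i = Maybe.≡-dec ℕ._≟_ (b i) (just m)

  startedBefore : ∀ b {i m m′} → b i ≡ just m → m ℕ.< m′ → StartedBefore b m′ i
  startedBefore b bᵢ≡m m<m′ rewrite bᵢ≡m = just m<m′

  startTime : ∀ b {m i} → StartedBefore b m i → ∃[ k ] (b i ≡ just k × k ℕ.< m)
  startTime b {i = i} started with b i | started
  ... | just k | just k<m = k , refl , k<m

  startedBefore-mono : ∀ b {i m m′} → m ℕ.≤ m′ → StartedBefore b m i → StartedBefore b m′ i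
  startedBefore-mono _ m≤m′ = Any.map (λ k<m → ℕ.<-≤-trans k<m m≤m′)

  -- For a unit job the last legal start is one before the deadline. Writing this as `m < d i`
  -- avoids truncated subtraction when `d i` is zero.
  InWindow : ℕ → Fin n → Set
  InWindow m i = a i ℕ.≤ m × m ℕ.< d i

  Pending : Plan → ℕ → Fin n → Set
  Pending b m i = InWindow m i × ¬ StartedBefore b m i

  pending? : ∀ b m → Decidable (Pending b m)
  pending? b m i = (a i ℕ.≤? m ×-dec m ℕ.<? d i) ×-dec ¬? (startedBefore? b m i)

  WithinWindows : Plan → Set
  WithinWindows b = ∀ {i m} → b i ≡ just m → InWindow m i

  OneAtATime : Plan → Set
  OneAtATime b = ∀ {i j m} → b i ≡ just m → b j ≡ just m → i ≡ j

  BusyAt : Plan → ℕ → Set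
  BusyAt b m = ∀ {i} → Pending b m i → ∃[ j ] b j ≡ just m

  -- `Pending b m` depends only on starts before `m`, so this condition on a complete plan records
  -- each choice as it looked when it was made.
  LatestFirst : Plan → Set
  LatestFirst b = ∀ {j m} → b j ≡ just m → ∀ {i} → Pending b m i → d i ℕ.≤ d j

  started⇒arrived : ∀ b {m i} → WithinWindows b → StartedBefore b m i → a i ℕ.≤ m
  started⇒arrived b {i = i} w s with startTime b {i = i} s
  ... | _ , bᵢ≡k , k<m = ℕ.≤-trans (proj₁ (w bᵢ≡k)) (ℕ.<⇒≤ k<m)

  startsAt⇒¬startedBefore : ∀ b {m i} → b i ≡ just m → ¬ StartedBefore b m i
  startsAt⇒¬startedBefore b {i = i} bᵢ≡m s with startTime b {i = i} s
  ... | _ , bᵢ≡k , k<m = ℕ.<⇒≢ k<m (Maybe.just-injective (trans (sym bᵢ≡k) bᵢ≡m))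

  DueStarted : Plan → ℕ → ℕ → Fin n → Set
  DueStarted b m x i = StartedBefore b m i × d i ℕ.< x

  dueStarted? : ∀ b m x → Decidable (DueStarted b m x)
  dueStarted? b m x i = startedBefore? b m i ×-dec d i ℕ.<? x

  started : Plan → ℕ → ℕ → Fin n → ℕ
  started b m x i = indicator (dueStarted? b m x i)

  #started : Plan → ℕ → ℕ → ℕ
  #started b m x = sum (started b m x)

  started-mono-≤ : ∀ b m x b′ m′ x′ i → (DueStarted b m x i → DueStarted b′ m′ x′ i) →
                   started b m x i ℕ.≤ started b′ m′ x′ i
  started-mono-≤ b m x b′ m′ x′ i = indicator-mono-≤ (dueStarted? b m x i) (dueStarted? b′ m′ x′ i)

  started-mono-< : ∀ b m x b′ m′ x′ i → ¬ DueStarted b m x i → DueStarted b′ m′ x′ i →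
                   started b m x i ℕ.< started b′ m′ x′ i
  started-mono-< b m x b′ m′ x′ i = indicator-mono-< (dueStarted? b m x i) (dueStarted? b′ m′ x′ i)

  dueStarted-suc : ∀ b m x i → DueStarted b m x i → DueStarted b (suc m) x i
  dueStarted-suc b m x i (s , dᵢ<x) = startedBefore-mono b (ℕ.n≤1+n m) s , dᵢ<x

  dueStarted-pred : ∀ b {m x i} → b i ≢ just m → DueStarted b (suc m) x i → DueStarted b m x i
  dueStarted-pred b {i = i} bᵢ≢m (s , dᵢ<x) with startTime b {i = i} s
  ... | k , bᵢ≡k , s≤s k≤m =
    startedBefore b bᵢ≡k (ℕ.≤∧≢⇒< k≤m (λ k≡m → bᵢ≢m (trans bᵢ≡k (cong just k≡m)))) , dᵢ<x

  #started-suc : ∀ b m x → #started b m x ℕ.≤ #started b (suc m) x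
  #started-suc b m x = sum-mono-≤ λ i →
    started-mono-≤ b m x b (suc m) x i (dueStarted-suc b m x i)

  -- A latest-due-first plan against a competitor.

  module _ {b b′ : Plan} {H : ℕ} (d<H : ∀ i → d i ℕ.< H)
           (window : WithinWindows b) (one : OneAtATime b) (latest : LatestFirst b)
           (window′ : WithinWindows b′) (busy′ : ∀ m → BusyAt b′ m) where

    -- The deadline of `i` lies beyond that of `j`, which is alive at `m`, so `i` is alive as well.
    -- Were `i` unstarted, it would be pending and preferable to `j`.
    latest⇒started : ∀ {m j x i} → b j ≡ just m → d j ℕ.< x → x ℕ.≤ d i → a i ℕ.≤ m →
                     StartedBefore b m i
    latest⇒started {m} {j} {x} {i} bⱼ≡m dⱼ<x x≤dᵢ aᵢ≤m =
      decidable-stable (startedBefore? b m i) λ ¬s →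
        ℕ.<⇒≱ dⱼ<dᵢ (latest bⱼ≡m ((aᵢ≤m , ℕ.<-trans (proj₂ (window bⱼ≡m)) dⱼ<dᵢ) , ¬s))
      where
      dⱼ<dᵢ : d j ℕ.< d i
      dⱼ<dᵢ = ℕ.<-≤-trans dⱼ<x x≤dᵢ

    -- Every arrived job due at x or later has been started by b but k has not
    -- been started by b′, so b′ spent more starts on the jobs due before x.
    lag-if-later : ∀ {m j k x} → b j ≡ just m → d j ℕ.< x → b′ k ≡ just m → x ℕ.≤ d k →
                   #started b m H ℕ.≤ #started b′ m H → #started b m x ℕ.< #started b′ m x
    lag-if-later {m} {j} {k} {x} bⱼ≡m dⱼ<x b′ₖ≡m x≤dₖ =
      sum-exchange-< (started b m x) (started b′ m x) (started b m H) (started b′ m H) le k lt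
      where
      swap : ∀ i → started b′ m x i ℕ.+ started b m H i ≡ started b m H i ℕ.+ started b′ m x i
      swap i = ℕ.+-comm (started b′ m x i) (started b m H i)

      le : ∀ i → started b m x i ℕ.+ started b′ m H i ℕ.≤ started b m H i ℕ.+ started b′ m x i
      le i with ℕ.<-≤-connex (d i) x
      ... | inj₁ dᵢ<x = ℕ.+-mono-≤
        (started-mono-≤ b m x b m H i λ (s , _) → s , d<H i)
        (started-mono-≤ b′ m H b′ m x i λ (s , _) → s , dᵢ<x)
      ... | inj₂ x≤dᵢ = ℕ.≤-trans (ℕ.+-mono-≤
        (started-mono-≤ b m x b′ m x i λ (_ , dᵢ<x) → contradiction x≤dᵢ (ℕ.<⇒≱ dᵢ<x))
        (started-mono-≤ b′ m H b m H i λ (s , _) →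
          latest⇒started bⱼ≡m dⱼ<x x≤dᵢ (started⇒arrived b′ window′ s) , d<H i))
        (ℕ.≤-reflexive (swap i))

      lt : started b m x k ℕ.+ started b′ m H k ℕ.< started b m H k ℕ.+ started b′ m x k
      lt = ℕ.<-≤-trans (ℕ.+-mono-≤-<
        (started-mono-≤ b m x b′ m x k λ (_ , dₖ<x) → contradiction x≤dₖ (ℕ.<⇒≱ dₖ<x))
        (started-mono-< b′ m H b m H k (startsAt⇒¬startedBefore b′ b′ₖ≡m ∘ proj₁)
          (latest⇒started bⱼ≡m dⱼ<x x≤dₖ (proj₁ (window′ b′ₖ≡m)) , d<H k)))
        (ℕ.≤-reflexive (swap k))

    -- Every job alive at m has been started by b′ but j has not been started by b.
    lag-if-idle : ∀ {m j x} → b j ≡ just m → d j ℕ.< x → (∀ k → b′ k ≢ just m) →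
                  #started b m (suc m) ℕ.≤ #started b′ m (suc m) →
                  #started b m x ℕ.< #started b′ m x
    lag-if-idle {m} {j} {x} bⱼ≡m dⱼ<x idle =
      sum-exchange-< (started b m x) (started b′ m x) (started b m (suc m)) (started b′ m (suc m)) le j lt
      where
      m<dⱼ : m ℕ.< d j
      m<dⱼ = proj₂ (window bⱼ≡m)

      started′ : ∀ {i} → InWindow m i → StartedBefore b′ m i
      started′ {i} w = decidable-stable (startedBefore? b′ m i) λ ¬s →
        let k , b′ₖ≡m = busy′ m (w , ¬s) in idle k b′ₖ≡m

      swap : ∀ i → started b′ m x i ℕ.+ started b m (suc m) i ≡
                   started b m (suc m) i ℕ.+ started b′ m x i
      swap i = ℕ.+-comm (started b′ m x i) (started b m (suc m) i)

      le : ∀ i → started b m x i ℕ.+ started b′ m (suc m) i ℕ.≤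
                 started b m (suc m) i ℕ.+ started b′ m x i
      le i with ℕ.<-≤-connex m (d i)
      -- The threshold `suc m` selects exactly the jobs expired at `m`. They are also due before
      -- `x`, since `m < d j < x`, so both thresholds count them alike.
      ... | inj₂ dᵢ≤m = ℕ.+-mono-≤
        (started-mono-≤ b m x b m (suc m) i λ (s , _) → s , s≤s dᵢ≤m)
        (started-mono-≤ b′ m (suc m) b′ m x i λ (s , _) →
          s , ℕ.≤-<-trans dᵢ≤m (ℕ.<-trans m<dⱼ dⱼ<x))
      ... | inj₁ m<dᵢ = ℕ.≤-trans (ℕ.+-mono-≤
        (started-mono-≤ b m x b′ m x i λ (s , dᵢ<x) →
          started′ (started⇒arrived b window s , m<dᵢ) , dᵢ<x)
        (started-mono-≤ b′ m (suc m) b m (suc m) i λ (_ , dᵢ≤m) →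
          contradiction m<dᵢ (ℕ.≤⇒≯ (ℕ.s≤s⁻¹ dᵢ≤m))))
        (ℕ.≤-reflexive (swap i))

      lt : started b m x j ℕ.+ started b′ m (suc m) j ℕ.< started b m (suc m) j ℕ.+ started b′ m x j
      lt = ℕ.<-≤-trans (ℕ.+-mono-<-≤
        (started-mono-< b m x b′ m x j (startsAt⇒¬startedBefore b bⱼ≡m ∘ proj₁)
          (started′ (window bⱼ≡m) , dⱼ<x))
        (started-mono-≤ b′ m (suc m) b m (suc m) j λ (_ , dⱼ≤m) →
          contradiction m<dⱼ (ℕ.≤⇒≯ (ℕ.s≤s⁻¹ dⱼ≤m))))
        (ℕ.≤-reflexive (swap j))

    -- Induction on `m` for all `x` at once: the step at `x` may call the hypothesis at `H` or at
    -- `suc m` in place of `x`.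
    latestFirst-minimal : ∀ m x → #started b m x ℕ.≤ #started b′ m x
    latestFirst-minimal zero x = sum-mono-≤ λ i →
      started-mono-≤ b 0 x b′ 0 x i λ (s , _) → contradiction (proj₂ (proj₂ (startTime b s))) λ ()
    latestFirst-minimal (suc m) x
      with Fin.any? (λ j → startsAt? b m j ×-dec d j ℕ.<? x)
    ... | no none = begin
      #started b (suc m) x   ≤⟨ sum-mono-≤ unchanged ⟩
      #started b m x         ≤⟨ latestFirst-minimal m x ⟩
      #started b′ m x        ≤⟨ #started-suc b′ m x ⟩
      #started b′ (suc m) x  ∎
      where
      open ℕ.≤-Reasoning
      unchanged : ∀ i → started b (suc m) x i ℕ.≤ started b m x i
      unchanged i = started-mono-≤ b (suc m) x b m x i λ s →
        dueStarted-pred b (λ bᵢ≡m → none (i , bᵢ≡m , proj₂ s)) s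
    -- Only `j` starts at `m`, so the count for `b` grows by at most one. It is enough that the old
    -- count lies strictly below the competitor's new one.
    ... | yes (j , bⱼ≡m , dⱼ<x) = ℕ.≤-trans
      (sum-≤-suc j (λ i i≢j → started-mono-≤ b (suc m) x b m x i
                     (dueStarted-pred b (λ bᵢ≡m → i≢j (one bᵢ≡m bⱼ≡m))))
                   (indicator-≤-suc (dueStarted? b (suc m) x j) (dueStarted? b m x j)))
      lag
      where
      lag : #started b m x ℕ.< #started b′ (suc m) x
      lag with Fin.any? (startsAt? b′ m)
      ... | no idle = ℕ.<-≤-trans
        (lag-if-idle bⱼ≡m dⱼ<x (λ k b′ₖ≡m → idle (k , b′ₖ≡m)) (latestFirst-minimal m (suc m)))
        (#started-suc b′ m x)
      ... | yes (k , b′ₖ≡m) with ℕ.<-≤-connex (d k) x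
      ...   | inj₂ x≤dₖ = ℕ.<-≤-trans
        (lag-if-later bⱼ≡m dⱼ<x b′ₖ≡m x≤dₖ (latestFirst-minimal m H)) (#started-suc b′ m x)
      -- The competitor also starts a job due before `x`, so its own count grows and the hypothesis
      -- at `x` itself suffices.
      ...   | inj₁ dₖ<x = ℕ.≤-<-trans (latestFirst-minimal m x)
        (sum-mono-< (λ i → started-mono-≤ b′ m x b′ (suc m) x i (dueStarted-suc b′ m x i)) k
          (started-mono-< b′ m x b′ (suc m) x k
            (startsAt⇒¬startedBefore b′ b′ₖ≡m ∘ proj₁)
            (startedBefore b′ b′ₖ≡m ℕ.≤-refl , dₖ<x)))

-- Order arithmetic and integer parts on the time axis.

module TimeAxisProperties {c ℓ₁ ℓ₂ : Level} (T : TimeAxis c ℓ₁ ℓ₂) where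
  open TimeAxis T

  decTotalOrder : DecTotalOrder c ℓ₁ ℓ₂
  decTotalOrder = record { isDecTotalOrder = isDecTotalOrder }

  open AbelianGroup abelianGroup public using (group; comm; assoc; identityˡ; identityʳ)
  open DecTotalOrder decTotalOrder public
    using (module Eq; antisym; ≤-respˡ-≈; ≤-respʳ-≈)
    renaming (refl to ≤-refl; reflexive to ≤-reflexive; trans to ≤-trans)
  open DecTotalOrderProperties decTotalOrder public
    using (<-compare; <⇒≱)
  open GroupProperties group using (∙-cancelʳ; //-rightDividesˡ; //-rightDividesʳ)

  ≤-<-trans : ∀ {x y z} → x ≤ y → y < z → x < z
  ≤-<-trans = ToStrict.≤-<-trans _≈_ _≤_ ≤-trans antisym ≤-respˡ-≈

  <-≤-trans : ∀ {x y z} → x < y → y ≤ z → x < z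
  <-≤-trans = ToStrict.<-≤-trans _≈_ _≤_ Eq.sym ≤-trans antisym ≤-respʳ-≈

  +-monoʳ-≤ : ∀ z {x y} → x ≤ y → z + x ≤ z + y
  +-monoʳ-≤ z {x} {y} x≤y = ≤-respˡ-≈ (comm x z) (≤-respʳ-≈ (comm y z) (+-monoˡ-≤ z x≤y))

  ≤-minus⇒+-≤ : ∀ {x y z} → x ≤ y - z → x + z ≤ y
  ≤-minus⇒+-≤ {y = y} {z} x≤y-z = ≤-respʳ-≈ (//-rightDividesˡ z y) (+-monoˡ-≤ z x≤y-z)

  +-≤⇒≤-minus : ∀ {x y z} → x + z ≤ y → x ≤ y - z
  +-≤⇒≤-minus {x} {z = z} x+z≤y = ≤-respˡ-≈ (//-rightDividesʳ z x) (+-monoˡ-≤ (- z) x+z≤y)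

  x<1+x : ∀ x → x < 1# + x
  x<1+x x = ≤-respˡ-≈ (identityˡ x) (+-monoˡ-≤ x (proj₁ 0<1))
          , λ x≈1+x → proj₂ 0<1 (∙-cancelʳ x 0# 1# (Eq.trans (identityˡ x) x≈1+x))

  -- `fromℕ 1` unfolds to `1# + 0#` and `fromℕ (suc m)` to `1# + fromℕ m`; with the unit on the
  -- left, the end of a unit interval matches the next integer.
  x+fromℕ1≈1+x : ∀ x → x + fromℕ 1 ≈ 1# + x
  x+fromℕ1≈1+x x = Eq.trans (Eq.sym (assoc x 1# 0#)) (Eq.trans (identityʳ (x + 1#)) (comm x 1#))

  0≤fromℕ : ∀ m → 0# ≤ fromℕ m
  0≤fromℕ zero    = ≤-refl
  0≤fromℕ (suc m) = ≤-trans (0≤fromℕ m) (proj₁ (x<1+x (fromℕ m)))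

  fromℕ-mono-≤ : ∀ {m n} → m ℕ.≤ n → fromℕ m ≤ fromℕ n
  fromℕ-mono-≤ {n = n} z≤n = 0≤fromℕ n
  fromℕ-mono-≤ (s≤s m≤n)   = +-monoʳ-≤ 1# (fromℕ-mono-≤ m≤n)

  fromℕ-mono-< : ∀ {m n} → m ℕ.< n → fromℕ m < fromℕ n
  fromℕ-mono-< {m} m<n = <-≤-trans (x<1+x (fromℕ m)) (fromℕ-mono-≤ m<n)

  fromℕ-cancel-≤ : ∀ {m n} → fromℕ m ≤ fromℕ n → m ℕ.≤ n
  fromℕ-cancel-≤ m≤n = ℕ.≮⇒≥ λ n<m → <⇒≱ (fromℕ-mono-< n<m) m≤n

  fromℕ-cancel-< : ∀ {m n} → fromℕ m < fromℕ n → m ℕ.< n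
  fromℕ-cancel-< m<n = ℕ.≰⇒> λ n≤m → <⇒≱ m<n (fromℕ-mono-≤ n≤m)

  -- The axis need not be Archimedean, so an integer bound `k` is supplied, and the search descends
  -- from it.
  floor : ∀ {x} k → 0# ≤ x → x < fromℕ k → ∃[ m ] (fromℕ m ≤ x × x < fromℕ (suc m))
  floor zero 0≤x x<0 = contradiction 0≤x (<⇒≱ x<0)
  floor {x} (suc k) 0≤x x<1+k with <-compare x (fromℕ k)
  ... | tri< x<k _ _ = floor k 0≤x x<k
  ... | tri≈ _ x≈k _ = k , ≤-reflexive (Eq.sym x≈k) , x<1+k
  ... | tri> _ _ k<x = k , proj₁ k<x , x<1+k

  -- From `fromℕ m ≤ τ < fromℕ (suc m′)` follows `m ≤ m′`, and symmetrically. Thus overlapping unit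
  -- executions with integral starts are recognised as simultaneous.
  floor-unique : ∀ m m′ {τ} → fromℕ m ≤ τ → τ < fromℕ (suc m) →
                 fromℕ m′ ≤ τ → τ < fromℕ (suc m′) → m ≡ m′
  floor-unique m m′ m≤τ τ<1+m m′≤τ τ<1+m′ = ℕ.≤-antisym
    (ℕ.s≤s⁻¹ (fromℕ-cancel-< {m} {suc m′} (≤-<-trans m≤τ τ<1+m′)))
    (ℕ.s≤s⁻¹ (fromℕ-cancel-< {m′} {suc m} (≤-<-trans m′≤τ τ<1+m)))

-- Partial functions: pointwise relations and updates.

module _ {a b r : Level} {A : Set a} {B : Set b} {R : REL A B r} where

  pointwise-justˡ : ∀ {x y u} → Pointwise R x y → x ≡ just u → ∃[ v ] (y ≡ just v × R u v)
  pointwise-justˡ (just r) refl = _ , refl , r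

  pointwise-justʳ : ∀ {x y v} → Pointwise R x y → y ≡ just v → ∃[ u ] (x ≡ just u × R u v)
  pointwise-justʳ (just r) refl = _ , refl , r

module _ {a : Level} {A : Set a} {n : ℕ} (b : Fin n → Maybe A) (j : Fin n) (v : A) where

  updateAt-just⁻ : ∀ {i u} → updateAt b j (const (just v)) i ≡ just u →
                   (i ≡ j × u ≡ v) ⊎ b i ≡ just u
  updateAt-just⁻ {i} eq with i Fin.≟ j
  ... | yes refl = inj₁ (refl , Maybe.just-injective (trans (sym eq) (updateAt-updates j b)))
  ... | no i≢j   = inj₂ (trans (sym (updateAt-minimal i j b i≢j)) eq)

  updateAt-just⁺ : b j ≡ nothing → ∀ {i u} → b i ≡ just u →
                   updateAt b j (const (just v)) i ≡ just u
  updateAt-just⁺ bⱼ≡nothing {i} bᵢ≡u =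
    trans (updateAt-minimal i j b λ { refl → contradiction (trans (sym bⱼ≡nothing) bᵢ≡u) λ () }) bᵢ≡u

-- Translation between schedules and integer plans.

module UnitScheduling {c ℓ₁ ℓ₂ : Level} (T : TimeAxis c ℓ₁ ℓ₂) (I : LBP)
                      (unit : ∀ i → LBP.t I i ≡ 1) where
  open TimeAxis T
  open TimeAxisProperties T
  open LBP I
  open Scheduling T I
  open UnitPlans a d

  s+t≈1+s : ∀ i s → s + fromℕ (t i) ≈ 1# + s
  s+t≈1+s i s rewrite unit i = x+fromℕ1≈1+x s

  ≤critical⇒<d : ∀ {i m} → fromℕ m ≤ critical i → m ℕ.< d i
  ≤critical⇒<d {i} {m} m≤c =
    fromℕ-cancel-≤ (≤-respˡ-≈ (s+t≈1+s i (fromℕ m)) (≤-minus⇒+-≤ m≤c))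

  <d⇒≤critical : ∀ {i m} → m ℕ.< d i → fromℕ m ≤ critical i
  <d⇒≤critical {i} {m} m<d =
    +-≤⇒≤-minus (≤-respˡ-≈ (Eq.sym (s+t≈1+s i (fromℕ m))) (fromℕ-mono-≤ m<d))

  -- This supplies the integer bound from which `floor` and `start-integral-below` descend.
  critical<d : ∀ i → critical i < fromℕ (d i)
  critical<d i = <-≤-trans (x<1+x (critical i))
    (≤-respˡ-≈ (s+t≈1+s i (critical i)) (≤-minus⇒+-≤ ≤-refl))

  -- A relation, because the start times of an arbitrary feasible schedule are integers only up to
  -- `_≈_`.
  Represents : Schedule → Plan → Set (c ⊔ ℓ₁)
  Represents σ b = ∀ i → Pointwise (λ s m → s ≈ fromℕ m) (σ i) (b i)

  module _ (i : Job) (m : ℕ) {s : Time} (s≈m : s ≈ fromℕ m) where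

    inInterval⁺ : ∀ {τ} → fromℕ m ≤ τ → τ < fromℕ (suc m) → InInterval i s τ
    inInterval⁺ m≤τ τ<1+m = ≤-respˡ-≈ (Eq.sym s≈m) m≤τ ,
      <-≤-trans τ<1+m (≤-respʳ-≈ (Eq.sym (s+t≈1+s i s)) (+-monoʳ-≤ 1# (≤-reflexive (Eq.sym s≈m))))

    inInterval⁻ : ∀ {τ} → InInterval i s τ → fromℕ m ≤ τ × τ < fromℕ (suc m)
    inInterval⁻ (s≤τ , τ<s+t) = ≤-respˡ-≈ s≈m s≤τ ,
      <-≤-trans τ<s+t (≤-respˡ-≈ (Eq.sym (s+t≈1+s i s)) (+-monoʳ-≤ 1# (≤-reflexive s≈m)))

  module _ {σ : Schedule} {b : Plan} (rep : Represents σ b) where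

    startsAt⇒processing : ∀ {j m τ} → b j ≡ just m → fromℕ m ≤ τ → τ < fromℕ (suc m) →
                          ProcessingAt σ τ
    startsAt⇒processing {j} {m} bⱼ≡m m≤τ τ<1+m with pointwise-justʳ (rep j) bⱼ≡m
    ... | s , σⱼ≡s , s≈m = j , s , σⱼ≡s , inInterval⁺ j m s≈m m≤τ τ<1+m

    processing⇒startsAt : ∀ {m} → ProcessingAt σ (fromℕ m) → ∃[ j ] b j ≡ just m
    processing⇒startsAt {m} (j , s , σⱼ≡s , s≤m<s+t) with pointwise-justˡ (rep j) σⱼ≡s
    ... | k , bⱼ≡k , s≈k =
      let k≤m , m<1+k = inInterval⁻ j k s≈k s≤m<s+t in
      j , trans bⱼ≡k (cong just (floor-unique k m k≤m m<1+k ≤-refl (x<1+x (fromℕ m))))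

    -- Arrivals are integral, so a job that has arrived by `τ` has arrived by the integer part `m`;
    -- moving back to `m` cannot make it late or already started. Idle moments between integers
    -- thereby reduce to integer ones.
    executable⇒pending : ∀ {i m τ} → fromℕ m ≤ τ → τ < fromℕ (suc m) →
                         Executable σ i τ → Pending b m i
    executable⇒pending {i} {m} m≤τ τ<1+m ex =
      ( ℕ.s≤s⁻¹ (fromℕ-cancel-< (≤-<-trans arrived τ<1+m))
      , ≤critical⇒<d (≤-trans m≤τ notLate)) , λ started →
      let k , bᵢ≡k , k<m = startTime b started
          s , σᵢ≡s , s≈k = pointwise-justʳ (rep i) bᵢ≡k
      in notStarted s σᵢ≡s (≤-<-trans (≤-reflexive s≈k) (<-≤-trans (fromℕ-mono-< k<m) m≤τ))
      where open Executable ex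

    pending⇒executable : ∀ {i m} → Pending b m i → Executable σ i (fromℕ m)
    pending⇒executable {i} {m} ((a≤m , m<d) , ¬started) = record
      { notStarted = λ s σᵢ≡s s<m →
          let k , bᵢ≡k , s≈k = pointwise-justˡ (rep i) σᵢ≡s in
          ¬started (startedBefore b bᵢ≡k
            (fromℕ-cancel-< (≤-<-trans (≤-reflexive (Eq.sym s≈k)) s<m)))
      ; arrived    = fromℕ-mono-≤ a≤m
      ; notLate    = <d⇒≤critical m<d
      }

    represented-feasible : WithinWindows b → OneAtATime b → (∀ m → BusyAt b m) → Feasible σ
    represented-feasible inWindow one busyAt = record
      { window   = λ i s σᵢ≡s →
          let m , bᵢ≡m , s≈m = pointwise-justˡ (rep i) σᵢ≡s
              a≤m , m<d      = inWindow bᵢ≡m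
          in ≤-respʳ-≈ (Eq.sym s≈m) (fromℕ-mono-≤ a≤m) , ≤-respˡ-≈ (Eq.sym s≈m) (<d⇒≤critical m<d)
      ; disjoint = λ i j s s′ i≢j σᵢ≡s σⱼ≡s′ τ (inᵢ , inⱼ) →
          let m , bᵢ≡m , s≈m    = pointwise-justˡ (rep i) σᵢ≡s
              m′ , bⱼ≡m′ , s≈m′ = pointwise-justˡ (rep j) σⱼ≡s′
              m≤τ , τ<1+m       = inInterval⁻ i m s≈m inᵢ
              m′≤τ , τ<1+m′     = inInterval⁻ j m′ s≈m′ inⱼ
          in i≢j (one bᵢ≡m (trans bⱼ≡m′ (cong just (floor-unique m′ m m′≤τ τ<1+m′ m≤τ τ<1+m))))
      -- Executability confines `τ` between `0#` and `fromℕ (d i)`, so `τ` has an integer part `m`.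
      -- The job that the plan starts at `m` occupies the whole unit interval containing `τ`.
      ; busy     = λ τ ¬processing i ex →
          let m , m≤τ , τ<1+m = floor (d i)
                (≤-trans (0≤fromℕ (a i)) (Executable.arrived ex))
                (≤-<-trans (Executable.notLate ex) (critical<d i))
              j , bⱼ≡m        = busyAt m (executable⇒pending m≤τ τ<1+m ex)
          in ¬processing (startsAt⇒processing bⱼ≡m m≤τ τ<1+m)
      }

  -- Integrality of feasible schedules.

  module _ {σ : Schedule} (feasible : Feasible σ) where
    open Feasible feasible

    -- A job starting strictly between k and k + 1 has already arrived at k,
    -- so by the busy requirement some job is running at k; by induction that
    -- job started exactly at k, and the two overlap.
    start-integral-below : ∀ k {i s} → σ i ≡ just s → s < fromℕ k → ∃[ m ] s ≈ fromℕ m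
    start-integral-below zero {i} {s} σᵢ≡s s<0 =
      contradiction (≤-trans (0≤fromℕ (a i)) (proj₁ (window i s σᵢ≡s))) (<⇒≱ s<0)
    start-integral-below (suc k) {i} {s} σᵢ≡s s<1+k with <-compare s (fromℕ k)
    ... | tri< s<k _ _ = start-integral-below k σᵢ≡s s<k
    ... | tri≈ _ s≈k _ = k , s≈k
    ... | tri> _ _ k<s = contradiction executable (busy (fromℕ k) ¬processing i)
      where
      executable : Executable σ i (fromℕ k)
      executable = record
        { notStarted = λ s′ σᵢ≡s′ s′<k → <⇒≱ k<s
            (subst (_≤ fromℕ k) (Maybe.just-injective (trans (sym σᵢ≡s′) σᵢ≡s)) (proj₁ s′<k))
        ; arrived    = fromℕ-mono-≤ {a i} {k} (ℕ.s≤s⁻¹ (fromℕ-cancel-< {a i} {suc k}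
            (≤-<-trans (proj₁ (window i s σᵢ≡s)) s<1+k)))
        ; notLate    = ≤-trans (proj₁ k<s) (proj₂ (window i s σᵢ≡s))
        }

      ¬processing : ¬ ProcessingAt σ (fromℕ k)
      ¬processing (j , s′ , σⱼ≡s′ , s′≤k , k<s′+t) with <-compare s′ (fromℕ k)
      ... | tri> _ _ k<s′ = <⇒≱ k<s′ s′≤k
      ... | tri< s′<k _ _ =
        let m , s′≈m    = start-integral-below k σⱼ≡s′ s′<k
            m≤k , k<1+m = inInterval⁻ j m s′≈m (s′≤k , k<s′+t)
        in proj₂ s′<k (Eq.trans s′≈m (Eq.reflexive (cong fromℕ
             (floor-unique m k m≤k k<1+m ≤-refl (x<1+x (fromℕ k))))))
      ... | tri≈ _ s′≈k _ = disjoint j i s′ s j≢i σⱼ≡s′ σᵢ≡s s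
        ( inInterval⁺ j k s′≈k (proj₁ k<s) s<1+k
        , ≤-refl , <-≤-trans (x<1+x s) (≤-reflexive (Eq.sym (s+t≈1+s i s))))
        where
        j≢i : j ≢ i
        j≢i refl = proj₂ k<s (Eq.trans (Eq.sym s′≈k)
          (Eq.reflexive (Maybe.just-injective (trans (sym σⱼ≡s′) σᵢ≡s))))

    start-integral : ∀ {i s} → σ i ≡ just s → ∃[ m ] s ≈ fromℕ m
    start-integral {i} {s} σᵢ≡s = start-integral-below (d i) σᵢ≡s
      (≤-<-trans (proj₂ (window i s σᵢ≡s)) (critical<d i))

    private
      -- Abstracting `σ i` to a variable `x` lets one match build both the integer start and its
      -- correctness, while the premise still receives the equation for `σ i`.
      represent : ∀ x → (∀ {s} → x ≡ just s → ∃[ m ] s ≈ fromℕ m) →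
                  ∃[ y ] Pointwise (λ s m → s ≈ fromℕ m) x y
      represent nothing  _        = nothing , nothing
      represent (just s) integral = let m , s≈m = integral refl in just m , just s≈m

    plan : Plan
    plan i = proj₁ (represent (σ i) start-integral)

    plan-represents : Represents σ plan
    plan-represents i = proj₂ (represent (σ i) start-integral)

    plan-withinWindows : WithinWindows plan
    plan-withinWindows {i} bᵢ≡m =
      let s , σᵢ≡s , s≈m = pointwise-justʳ (plan-represents i) bᵢ≡m
          a≤s , s≤c      = window i s σᵢ≡s
      in fromℕ-cancel-≤ (≤-respʳ-≈ s≈m a≤s) , ≤critical⇒<d (≤-respˡ-≈ s≈m s≤c)

    plan-busy : ∀ m → BusyAt plan m
    plan-busy m {i} pending with Fin.any? (startsAt? plan m)
    ... | yes starts = starts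
    ... | no ¬starts = contradiction (pending⇒executable plan-represents pending)
      (busy (fromℕ m) (¬starts ∘ processing⇒startsAt plan-represents) i)

  -- Invariants along a run of the policy.

  record Trace (τ : ℕ) (σ : Schedule) : Set (c ⊔ ℓ₁) where
    field
      starts        : Plan
      represents    : Represents σ starts
      early         : ∀ {i m} → starts i ≡ just m → m ℕ.< τ
      withinWindows : WithinWindows starts
      oneAtATime    : OneAtATime starts
      latestFirst   : LatestFirst starts
      busyBefore    : ∀ {m} → m ℕ.< τ → BusyAt starts m

    -- Every recorded start is an integer before `τ`, so its unit job has ended by `τ`. Hence the
    -- `continue` rule never applies.
    ¬processing : ¬ ProcessingAt σ (fromℕ τ)
    ¬processing p = let _ , bⱼ≡τ = processing⇒startsAt represents p in ℕ.<-irrefl refl (early bⱼ≡τ)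

  trace-begin : Trace 0 (replicate n nothing)
  trace-begin = record
    { starts        = λ _ → nothing
    ; represents    = λ _ → nothing
    ; early         = λ ()
    ; withinWindows = λ ()
    ; oneAtATime    = λ ()
    ; latestFirst   = λ ()
    ; busyBefore    = λ ()
    }

  trace-idle : ∀ {τ σ} → Trace τ σ → (∀ i → ¬ Executable σ i (fromℕ τ)) → Trace (suc τ) σ
  trace-idle {τ} {σ} tr ¬ex = record
    { starts        = starts
    ; represents    = represents
    ; early         = ℕ.m<n⇒m<1+n ∘ early
    ; withinWindows = withinWindows
    ; oneAtATime    = oneAtATime
    ; latestFirst   = latestFirst
    ; busyBefore    = busyBefore′
    }
    where
    open Trace tr
    busyBefore′ : ∀ {m} → m ℕ.< suc τ → BusyAt starts m
    busyBefore′ m<1+τ {i} pending with ℕ.m<1+n⇒m<n∨m≡n m<1+τ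
    ... | inj₁ m<τ  = busyBefore m<τ pending
    ... | inj₂ refl = contradiction (pending⇒executable represents pending) (¬ex i)

  trace-start : ∀ {τ σ} → Trace τ σ → ∀ j → LatestDue σ (fromℕ τ) j →
                Trace (suc τ) (updateAt σ j (const (just (fromℕ τ))))
  trace-start {τ} {σ} tr j due = record
    { starts        = b′
    ; represents    = represents′
    ; early         = early′
    ; withinWindows = withinWindows′
    ; oneAtATime    = oneAtATime′
    ; latestFirst   = latestFirst′
    ; busyBefore    = busyBefore′
    }
    where
    open Trace tr renaming (starts to b)
    open LatestDue due

    b′ : Plan
    b′ = updateAt b j (const (just τ))

    jPending : Pending b τ j
    jPending = executable⇒pending represents ≤-refl (x<1+x (fromℕ τ)) executable

    -- The update overwrites no start: by `early`, a recorded start of `j` would precede `τ`,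
    -- whereas `j` is pending at `τ`.
    bⱼ≡nothing : b j ≡ nothing
    bⱼ≡nothing with b j in eq
    ... | nothing = refl
    ... | just _  = contradiction (startedBefore b eq (early eq)) (proj₂ jPending)

    old : ∀ {i m} → b i ≡ just m → b′ i ≡ just m
    old = updateAt-just⁺ b j τ bⱼ≡nothing

    cases : ∀ {i m} → b′ i ≡ just m → (i ≡ j × m ≡ τ) ⊎ b i ≡ just m
    cases = updateAt-just⁻ b j τ

    -- `b′` extends `b`, so it can only have fewer pending jobs; the earlier `latestFirst` and
    -- `busyBefore` therefore survive the new start.
    oldPending : ∀ {i m} → Pending b′ m i → Pending b m i
    oldPending (w , ¬started) = w , λ started →
      let _ , bᵢ≡k , k<m = startTime b started in ¬started (startedBefore b′ (old bᵢ≡k) k<m)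

    represents′ : Represents (updateAt σ j (const (just (fromℕ τ)))) b′
    represents′ i with i Fin.≟ j
    ... | yes refl rewrite updateAt-updates j {const (just (fromℕ τ))} σ
                         | updateAt-updates j {const (just τ)} b = just Eq.refl
    ... | no i≢j rewrite updateAt-minimal i j {const (just (fromℕ τ))} σ i≢j
                       | updateAt-minimal i j {const (just τ)} b i≢j = represents i

    early′ : ∀ {i m} → b′ i ≡ just m → m ℕ.< suc τ
    early′ b′ᵢ≡m with cases b′ᵢ≡m
    ... | inj₁ (_ , refl) = ℕ.≤-refl
    ... | inj₂ bᵢ≡m       = ℕ.m<n⇒m<1+n (early bᵢ≡m)

    withinWindows′ : WithinWindows b′
    withinWindows′ b′ᵢ≡m with cases b′ᵢ≡m
    ... | inj₁ (refl , refl) = proj₁ jPending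
    ... | inj₂ bᵢ≡m          = withinWindows bᵢ≡m

    oneAtATime′ : OneAtATime b′
    oneAtATime′ b′ᵢ≡m b′ₖ≡m with cases b′ᵢ≡m | cases b′ₖ≡m
    ... | inj₁ (refl , _) | inj₁ (refl , _) = refl
    ... | inj₁ (_ , refl) | inj₂ bₖ≡m       = contradiction (early bₖ≡m) (ℕ.<-irrefl refl)
    ... | inj₂ bᵢ≡m       | inj₁ (_ , refl) = contradiction (early bᵢ≡m) (ℕ.<-irrefl refl)
    ... | inj₂ bᵢ≡m       | inj₂ bₖ≡m       = oneAtATime bᵢ≡m bₖ≡m

    latestFirst′ : LatestFirst b′
    latestFirst′ b′ᵢ≡m {k} pending with cases b′ᵢ≡m
    ... | inj₁ (refl , refl) = latest k (pending⇒executable represents (oldPending pending))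
    ... | inj₂ bᵢ≡m          = latestFirst bᵢ≡m (oldPending pending)

    busyBefore′ : ∀ {m} → m ℕ.< suc τ → BusyAt b′ m
    busyBefore′ m<1+τ pending with ℕ.m<1+n⇒m<n∨m≡n m<1+τ
    ... | inj₁ m<τ  = let k , bₖ≡m = busyBefore m<τ (oldPending pending) in k , old bₖ≡m
    ... | inj₂ refl = j , updateAt-updates j b

  trace : ∀ {τ σ} → LDDRun τ σ → Trace τ σ
  trace begin               = trace-begin
  trace (continue run p)    = contradiction p (Trace.¬processing (trace run))
  trace (idle run _ ¬ex)    = trace-idle (trace run) ¬ex
  trace (start run _ j due) = trace-start (trace run) j due

  -- The decidable predicate `Pending` of the traced plan stands in for `Executable`. The two
  -- outcomes of `argmax` are exactly the rules `idle` and `start`.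
  LDDRun-exists : ∀ τ → ∃[ σ ] LDDRun τ σ
  LDDRun-exists zero    = replicate n nothing , begin
  LDDRun-exists (suc τ) with LDDRun-exists τ
  ... | σ , run = extend (argmax (pending? starts τ) d)
    where
    open Trace (trace run)
    toPending : ∀ {i} → Executable σ i (fromℕ τ) → Pending starts τ i
    toPending = executable⇒pending represents ≤-refl (x<1+x (fromℕ τ))

    extend : (∀ i → ¬ Pending starts τ i) ⊎
             (∃[ j ] (Pending starts τ j × ∀ i → Pending starts τ i → d i ℕ.≤ d j)) →
             ∃[ σ′ ] LDDRun (suc τ) σ′
    extend (inj₁ none) = σ , idle run ¬processing λ i → none i ∘ toPending
    extend (inj₂ (j , pending , max)) = _ , start run ¬processing j record
      { executable = pending⇒executable represents pending
      ; latest     = λ k → max k ∘ toPending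
      }

  LDD-exists : ∃[ σ ] LDDSchedule σ
  LDD-exists =
    let H , d<H = upper-bound d
        σ , run = LDDRun-exists H
    in σ , H , d<H , run

  -- Work as a count, and optimality.

  -- With `H` above all deadlines, every executed job starts before `H` and is due before `H`, so
  -- both thresholds are vacuous and each executed job contributes one.
  work≡#started : ∀ {σ b H} → Represents σ b → WithinWindows b → (∀ i → d i ℕ.< H) →
                  work σ ≡ #started b H H
  work≡#started {σ} {b} {H} rep window d<H = sum-cong-≗ λ i → term i (dueStarted? b H H i)
    where
    term : ∀ i (due? : Dec (DueStarted b H H i)) → maybe′ (const (t i)) 0 (σ i) ≡ indicator due?
    term i (yes (started , _)) =
      let _ , bᵢ≡m , _ = startTime b started
          _ , σᵢ≡s , _ = pointwise-justʳ (rep i) bᵢ≡m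
      in trans (cong (maybe′ (const (t i)) 0) σᵢ≡s) (unit i)
    term i (no ¬started) with σ i in σᵢ≡
    ... | nothing = refl
    ... | just s  =
      let _ , bᵢ≡m , _ = pointwise-justˡ (rep i) σᵢ≡ in contradiction
        (startedBefore b bᵢ≡m (ℕ.<-trans (proj₂ (window bᵢ≡m)) (d<H i)) , d<H i) ¬started

  LDD-feasible×minimal : ∀ σ → LDDSchedule σ → Feasible σ × MinimizesWork σ
  LDD-feasible×minimal σ (H , d<H , run) =
    represented-feasible represents withinWindows oneAtATime busyAlways , minimal
    where
    open Trace (trace run)
    busyAlways : ∀ m → BusyAt starts m
    -- A pending job gives `m < d i < H`, so a run up to `H` covers every moment at which the busy
    -- requirement has content.
    busyAlways m {i} pending@((_ , m<d) , _) = busyBefore (ℕ.<-trans m<d (d<H i)) pending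

    minimal : MinimizesWork σ
    minimal σ′ feasible = begin′
      work σ                        ≡⟨ work≡#started represents withinWindows d<H ⟩
      #started starts H H           ≤⟨ latestFirst-minimal d<H withinWindows oneAtATime latestFirst
                                         inWindows′ (plan-busy feasible) H H ⟩
      #started (plan feasible) H H  ≡⟨ work≡#started (plan-represents feasible) inWindows′ d<H ⟨
      work σ′                       ∎
      where
      open ℕ.≤-Reasoning renaming (begin_ to begin′_)
      inWindows′ : WithinWindows (plan feasible)
      inWindows′ = plan-withinWindows feasible

-- The first component ensures that the second is not vacuous; the second covers every way of
-- breaking ties.
theorem3 : ∀ {c ℓ₁ ℓ₂ : Level} (T : TimeAxis c ℓ₁ ℓ₂) (I : LBP) →
    let open Scheduling T I in
    (∀ i → LBP.t I i ≡ 1) →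
    (∃[ σ ] LDDSchedule σ) ×
    (∀ σ → LDDSchedule σ → Feasible σ × MinimizesWork σ)
theorem3 T I unit = LDD-exists , LDD-feasible×minimal
  where open UnitScheduling T I unit
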